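{- Let $G=(V,E)$ be a finite simple undirected graph, let $\kappa$ be a positive integer, and let $C\in C(A)$ be such that $|C|=\kappa+1$. The inequality \[\sum_{(i,j)\in C} w_{ij}\le z\] defines a facet of $P_{G,\kappa}$.
   Context: Let $m=|E|$. Let $D=(V,A)$ be the directed graph with $A=\{(i,j),(j,i)\mid [i,j]\in E\}$. Paths are directed and elementary (no repeated vertices); paths and cycles are identified with their arc sets. $P_\kappa(A)$ denotes the set of all paths in $D$ with exactly $\kappa$ arcs, and $C(A)$ the set of all directed (elementary) cycles in $D$ (including those of length 2), with $|C|$ the number of arcs of $C$. The polytope $P_{G,\kappa}$ is the convex hull of all $(w,z)\in\mathbb{R}^{2m}\times\mathbb{R}$, $w=(w_{ij})_{(i,j)\in A}$, satisfying (1) $w_{ij}+w_{ji}\le 1$ for all $[i,j]\in E$; (2) $\sum_{(i,j)\in C}w_{ij}\le |C|-1$ for all $C\in C(A)$; (3) $\sum_{(i,j)\in p}w_{ij}\le z$ for all $p\in P_\kappa(A)$; (4) $w_{ij}\in\{0,1\}$ for all $(i,j)\in A$; (5) $0\le z\le\kappa$. An inequality defines a facet of $P_{G,\kappa}$ if it is valid for $P_{G,\kappa}$ (satisfied by all its points) and the set of points of $P_{G,\kappa}$ satisfying it with equality has dimension $\dim(P_{G,\kappa})-1$. -}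

module Defs where

open import Algebra.Apartness.Bundles using (HeytingField; HeytingCommutativeRing)
open import Algebra.Bundles using (CommutativeRing; Semiring)
open import Data.Bool.Base using (Bool; T)
open import Data.Fin.Base using (Fin; zero; suc; inject₁; fromℕ)
open import Data.Integer.Base as ℤ using (ℤ; +_; 1ℤ)
open import Data.Nat.Base as ℕ using (ℕ; suc)
open import Data.Product.Base using (Σ; _×_; _,_; ∃)
open import Data.Sum.Base using (_⊎_)
open import Data.Vec.Functional using (Vector; _∷_)
open import Function.Definitions using (Injective)
open import Level using (_⊔_) renaming (suc to lsuc)
open import Relation.Binary.Core using (Rel)
open import Relation.Binary.PropositionalEquality.Core using (_≡_)
open import Relation.Binary.Structures using (IsStrictPartialOrder)
open import Relation.Nullary.Negation.Core using (¬_)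
open import Relation.Unary using (Pred; _∈_; _⊆_; _∩_)

import Algebra.Definitions.RawSemiring as RawSemiringDefinitions

-- The real numbers, axiomatised as an Archimedean, Cauchy-complete ordered
-- field.  The axioms are the constructive ones (the Bishop reals satisfy
-- them); classically they determine the field up to unique isomorphism.
record RealNumbers c ℓ₁ ℓ₂ : Set (lsuc (c ⊔ ℓ₁ ⊔ ℓ₂)) where
  infix 4 _<_ _≤_

  field
    heytingField : HeytingField c ℓ₁ ℓ₂

  open HeytingField heytingField public

  open HeytingCommutativeRing heytingCommutativeRing public
    using (commutativeRing)
  open CommutativeRing commutativeRing public
    using (semiring; ring)

  open RawSemiringDefinitions (Semiring.rawSemiring semiring) public
    using (sum)
    renaming (_×_ to _·_)

  natural : ℕ → Carrier
  natural n = n · 1#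

  field
    _<_                  : Rel Carrier ℓ₂
    isStrictPartialOrder : IsStrictPartialOrder _≈_ _<_
    #⇒<⊎>                : ∀ {x y} → x # y → x < y ⊎ y < x
    <⇒#                  : ∀ {x y} → x < y → x # y
    +-monoˡ-<            : ∀ z {x y} → x < y → x + z < y + z
    *-pos                : ∀ {x y} → 0# < x → 0# < y → 0# < x * y

  _≤_ : Rel Carrier ℓ₂
  x ≤ y = ¬ (y < x)

  Cauchy : (ℕ → Carrier) → Set _
  Cauchy s = ∀ ε → 0# < ε → ∃ λ N → ∀ m n → N ℕ.≤ m → N ℕ.≤ n →
    s m - s n < ε

  _ConvergesTo_ : (ℕ → Carrier) → Carrier → Set _
  s ConvergesTo l = ∀ ε → 0# < ε → ∃ λ N → ∀ n → N ℕ.≤ n →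
    s n - l < ε × l - s n < ε

  field
    archimedean : ∀ x → ∃ λ n → x < natural n
    complete    : ∀ s → Cauchy s → ∃ λ l → s ConvergesTo l

record SimpleGraph : Set where
  field
    order     : ℕ
    adjacent  : Fin order → Fin order → Bool
    symmetric : ∀ i j → T (adjacent i j) → T (adjacent j i)
    loopless  : ∀ i → ¬ T (adjacent i i)

  Vertex : Set
  Vertex = Fin order

module _ (G : SimpleGraph) where
  open SimpleGraph G

  record Arc : Set where
    constructor arc
    field
      source target : Vertex
      edge          : T (adjacent source target)

  reverse : Arc → Arc
  reverse (arc i j e) = arc j i (symmetric i j e)

  record Path (k : ℕ) : Set where
    field
      vertex     : Vector Vertex (suc k)
      elementary : Injective _≡_ _≡_ vertex
      edges      : ∀ (i : Fin k) → T (adjacent (vertex (inject₁ i)) (vertex (suc i)))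

    arcs : Vector Arc k
    arcs i = arc (vertex (inject₁ i)) (vertex (suc i)) (edges i)

  -- A cycle is an elementary path together with an arc from its last vertex
  -- back to its first; loop-freeness of the graph forces at least two arcs.
  record Cycle : Set where
    field
      {k}     : ℕ
      path    : Path k
      closing : T (adjacent (Path.vertex path (fromℕ k)) (Path.vertex path zero))

    length : ℕ
    length = suc k

    arcs : Vector Arc length
    arcs = arc _ _ closing ∷ Path.arcs path

module Polyhedral {c ℓ₁ ℓ₂} (R : RealNumbers c ℓ₁ ℓ₂) (G : SimpleGraph) where
  open RealNumbers R

  record Point : Set c where
    constructor point
    field
      w : Arc G → Carrier
      z : Carrier

  open Point public

  infix 4 _≋_

  _≋_ : Rel Point ℓ₁
  x ≋ y = (∀ a → w x a ≈ w y a) × z x ≈ z y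

  origin : Point
  origin = point (λ _ → 0#) 0#

  combination : ∀ {k} → Vector Carrier k → Vector Point k → Point
  combination μ p =
    point (λ a → sum λ i → μ i * w (p i) a) (sum λ i → μ i * z (p i))

  ConvexHull : ∀ {ℓ} → Pred Point ℓ → Pred Point (c ⊔ ℓ₁ ⊔ ℓ₂ ⊔ ℓ)
  ConvexHull S x = ∃ λ k → Σ (Vector Carrier k) λ μ → Σ (Vector Point k) λ p →
    (∀ i → 0# ≤ μ i) × sum μ ≈ 1# × (∀ i → p i ∈ S) × x ≋ combination μ p

  AffinelyIndependent : ∀ {k} → Vector Point k → Set (c ⊔ ℓ₁)
  AffinelyIndependent {k} p = ∀ (μ : Vector Carrier k) →
    sum μ ≈ 0# → combination μ p ≋ origin → ∀ i → μ i ≈ 0#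

  -- The affine dimension: one less than the largest number of affinely
  -- independent points, so that the empty set has dimension -1.
  HasDimension : ∀ {ℓ} → Pred Point ℓ → ℤ → Set (c ⊔ ℓ₁ ⊔ ℓ)
  HasDimension S d = ∃ λ k →
    d ≡ + k ℤ.- 1ℤ ×
    (Σ (Vector Point k) λ p → (∀ i → p i ∈ S) × AffinelyIndependent p) ×
    (∀ {l} (q : Vector Point l) → (∀ i → q i ∈ S) → AffinelyIndependent q → l ℕ.≤ k)

  DefinesFacet : ∀ {ℓ} → Pred Point ℓ → (f g : Point → Carrier) → Set (c ⊔ ℓ₁ ⊔ ℓ₂ ⊔ ℓ)
  DefinesFacet P f g =
    P ⊆ (λ x → f x ≤ g x) ×
    (∃ λ d → HasDimension P d × HasDimension (P ∩ λ x → f x ≈ g x) (d ℤ.- 1ℤ))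

  weight : ∀ {k} → Vector (Arc G) k → Point → Carrier
  weight as x = sum λ i → w x (as i)

  record Feasible (κ : ℕ) (x : Point) : Set (c ⊔ ℓ₁ ⊔ ℓ₂) where
    field
      edge-bound  : ∀ a → w x a + w x (reverse G a) ≤ 1#
      cycle-bound : ∀ (C : Cycle G) →
                    weight (Cycle.arcs C) x ≤ natural (Cycle.length C) - 1#
      path-bound  : ∀ (p : Path G κ) → weight (Path.arcs p) x ≤ z x
      binary      : ∀ a → w x a ≈ 0# ⊎ w x a ≈ 1#
      z-lower     : 0# ≤ z x
      z-upper     : z x ≤ natural κ

  Polytope : ℕ → Pred Point (c ⊔ ℓ₁ ⊔ ℓ₂)
  Polytope κ = ConvexHull (Feasible κ)

module Submission where

open import Data.Bool.Base using (T; true; false)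
open import Data.Bool.Properties using (T-irrelevant)
open import Data.Empty using (⊥)
open import Data.Fin.Base using (Fin; zero; suc; inject₁; fromℕ; punchIn; punchOut)
open import Data.Fin.Induction using (<-weakInduction; >-weakInduction)
open import Data.Fin.Properties
  using (_≟_; punchIn-punchOut; punchInᵢ≢i; 0↔⊥; 1↔⊤; +↔⊎; fromℕ≢inject₁; inject₁-injective; any?; ¬∀⟶∃¬)
import Data.Integer.Base as ℤ
open import Data.Nat.Base as ℕ using (ℕ; zero; suc; NonZero; s<s⁻¹; s≤s⁻¹)
import Data.Nat.Properties as ℕ
open import Data.Product.Base using (Σ; _×_; _,_; ∃; proj₁; proj₂)
open import Data.Sum.Base using (_⊎_; inj₁; inj₂; swap)
open import Data.Sum.Function.Propositional using (_⊎-↔_)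
open import Data.Vec.Functional using (Vector; _∷_; head; tail; removeAt)
open import Function.Base using (_∘_; id)
open import Function.Bundles using (_↔_; mk↔ₛ′; module Inverse)
open import Function.Definitions using (Injective)
open import Function.Properties.Inverse using (↔-trans)
open import Level using (_⊔_)
open import Relation.Binary.Definitions using (DecidableEquality)
open import Relation.Binary.PropositionalEquality as ≡ using (_≡_; _≢_; module ≡-Reasoning)
open import Relation.Binary.Structures using (IsStrictPartialOrder)
open import Relation.Nullary.Decidable using (Dec; yes; no; map′; _×-dec_; _⊎-dec_; ¬?)
open import Relation.Nullary.Negation.Core using (¬_; contradiction)
open import Relation.Unary using (Pred; _∈_; _⊆_; _∩_)
open import Defs

import Algebra.Apartness.Properties.HeytingCommutativeRing as HeytingProperties
import Algebra.Properties.Ring as RingProperties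
import Algebra.Properties.Semiring.Sum as SumProperties
import Relation.Binary.Reasoning.Setoid as SetoidReasoning

-- Validity: a feasible point misses some arc of C, and the other κ arcs of C
-- form a path.  Dimension: for every arc a let S(a) be C with a added (if it
-- is not there) and with the arc of C entering the source of a removed.  S(a)
-- is acyclic: a cycle through a would need an arc entering the source of a,
-- and a cycle inside C is all of C.  The points (χ S(a), κ) together with the
-- origin are |A| + 1 affinely independent points of the face: the coordinates
-- of arcs off C isolate the coefficients of those arcs, then the coordinates
-- on C, subtracted from the vanishing sum of all coefficients, isolate the
-- others.  The point (0, κ) lies off the face, so coning over it transfers
-- bounds on the number of independent points between P and the face, and the
-- upper bound |A| + 2 is the solvability of a homogeneous linear system with
-- more unknowns than equations.

-- Arithmetic and order in a constructive ordered field.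

module OrderedField {c ℓ₁ ℓ₂} (R : RealNumbers c ℓ₁ ℓ₂) where
  open RealNumbers R public hiding (zero)
  open HeytingProperties heytingCommutativeRing public using (1#0; #-congˡ)
  open RingProperties ring public
  open SumProperties semiring public hiding (sum)
  open SetoidReasoning setoid
  open IsStrictPartialOrder isStrictPartialOrder public
    using (<-respʳ-≈; <-respˡ-≈)
    renaming (irrefl to <-irrefl; trans to <-trans; asym to <-asym)

  private variable
    m n : ℕ
    a b x y x′ y′ : Carrier

  #-cancel : a # b → x * a ≈ x * b → x ≈ 0#
  #-cancel {a} {b} {x} a#b xa≈xb with #⇒invertible a#b
  ... | i , _ , [a-b]i≈1 = begin
    x                      ≈⟨ *-identityʳ x ⟨
    x * 1#                 ≈⟨ *-congˡ [a-b]i≈1 ⟨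
    x * ((a - b) * i)      ≈⟨ *-assoc x (a - b) i ⟨
    x * (a - b) * i        ≈⟨ *-congʳ (x[y-z]≈xy-xz x a b) ⟩
    (x * a - x * b) * i    ≈⟨ *-congʳ (+-congʳ xa≈xb) ⟩
    (x * b - x * b) * i    ≈⟨ *-congʳ (-‿inverseʳ (x * b)) ⟩
    0# * i                 ≈⟨ zeroˡ i ⟩
    0#                     ∎

  -- If instead `1# < 0#`, then `- 1#` is positive, and hence so is its square `1#`.
  0<1 : 0# < 1#
  0<1 with #⇒<⊎> 1#0
  ... | inj₂ 0<1 = 0<1
  ... | inj₁ 1<0 = contradiction 1<0 (<-asym (<-respʳ-≈ eq (*-pos 0<-1 0<-1)))
    where
    0<-1 : 0# < - 1#
    0<-1 = <-respˡ-≈ (-‿inverseʳ 1#) (<-respʳ-≈ (+-identityˡ (- 1#)) (+-monoˡ-< (- 1#) 1<0))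
    eq : - 1# * - 1# ≈ 1#
    eq = trans (-1*x≈-x (- 1#)) (-‿involutive 1#)

  -- Takes the place of trichotomy: since `≤` is a negated `<`, chains mixing the two are handled by
  -- comparing with a third element.
  <-cotrans : ∀ z → x < y → x < z ⊎ z < y
  <-cotrans z x<y with #-cotrans (<⇒# x<y) z
  ... | inj₁ x#z with #⇒<⊎> x#z
  ...   | inj₁ x<z = inj₁ x<z
  ...   | inj₂ z<x = inj₂ (<-trans z<x x<y)
  <-cotrans z x<y | inj₂ z#y with #⇒<⊎> z#y
  ...   | inj₁ z<y = inj₂ z<y
  ...   | inj₂ y<z = inj₁ (<-trans x<y y<z)

  <⇒≤ : x < y → x ≤ y
  <⇒≤ x<y y<x = <-asym x<y y<x

  ≤-reflexive : x ≈ y → x ≤ y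
  ≤-reflexive x≈y y<x = <-irrefl (sym x≈y) y<x

  ≤-trans : x ≤ y → y ≤ a → x ≤ a
  ≤-trans {y = y} x≤y y≤a a<x with <-cotrans y a<x
  ... | inj₁ a<y = y≤a a<y
  ... | inj₂ y<x = x≤y y<x

  ≤-respˡ-≈ : x ≈ x′ → x ≤ y → x′ ≤ y
  ≤-respˡ-≈ eq = ≤-trans (≤-reflexive (sym eq))

  ≤-respʳ-≈ : y ≈ y′ → x ≤ y → x ≤ y′
  ≤-respʳ-≈ eq x≤y = ≤-trans x≤y (≤-reflexive eq)

  +-monoˡ-≤ : ∀ z → x ≤ y → x + z ≤ y + z
  +-monoˡ-≤ {x} {y} z x≤y lt =
    x≤y (<-respˡ-≈ (//-rightDividesʳ z y) (<-respʳ-≈ (//-rightDividesʳ z x) (+-monoˡ-< (- z) lt)))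

  +-mono-≤ : x ≤ x′ → y ≤ y′ → x + y ≤ x′ + y′
  +-mono-≤ {x} {x′} {y} {y′} x≤x′ y≤y′ = ≤-trans (+-monoˡ-≤ y x≤x′)
    (≤-respˡ-≈ (+-comm y x′) (≤-respʳ-≈ (+-comm y′ x′) (+-monoˡ-≤ x′ y≤y′)))

  *-monoʳ-< : 0# < a → x < y → a * x < a * y
  *-monoʳ-< {a} {x} {y} 0<a x<y =
    <-respˡ-≈ (+-identityˡ (a * x)) (<-respʳ-≈ eq (+-monoˡ-< (a * x) (*-pos 0<a 0<y-x)))
    where
    0<y-x : 0# < y - x
    0<y-x = <-respˡ-≈ (-‿inverseʳ x) (+-monoˡ-< (- x) x<y)
    eq : a * (y - x) + a * x ≈ a * y
    eq = trans (sym (distribˡ a (y - x) x)) (*-congˡ (//-rightDividesˡ x y))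

  -- The goal is a negation, so tightness allows the factors to be split into
  -- the cases of apartness and equality.
  *-monoʳ-≤ : 0# ≤ a → x ≤ y → a * x ≤ a * y
  *-monoʳ-≤ {a} {x} {y} 0≤a x≤y ay<ax = <-irrefl (trans (ax≈0 y) (sym (ax≈0 x))) ay<ax
    where
    a≈0 : a ≈ 0#
    a≈0 = proj₁ (tight a 0#) λ a#0 → <-irrefl (*-congˡ (sym (x≈y a#0))) ay<ax
      where
      x≈y : a # 0# → x ≈ y
      x≈y a#0 = proj₁ (tight x y) λ x#y → case (#⇒<⊎> a#0) (#⇒<⊎> x#y)
        where
        case : a < 0# ⊎ 0# < a → x < y ⊎ y < x → _
        case (inj₁ a<0) _          = 0≤a a<0
        case (inj₂ _)   (inj₂ y<x) = x≤y y<x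
        case (inj₂ 0<a) (inj₁ x<y) = <-asym ay<ax (*-monoʳ-< 0<a x<y)
    ax≈0 : ∀ x → a * x ≈ 0#
    ax≈0 x = trans (*-congʳ a≈0) (zeroˡ x)

  sum-mono-≤ : {f g : Vector Carrier n} → (∀ i → f i ≤ g i) → sum f ≤ sum g
  sum-mono-≤ {zero}  f≤g = ≤-reflexive refl
  sum-mono-≤ {suc n} f≤g = +-mono-≤ (f≤g zero) (sum-mono-≤ (f≤g ∘ suc))

  natural-<-suc : ∀ n → natural n < natural (suc n)
  natural-<-suc n = <-respˡ-≈ (+-identityˡ (natural n)) (+-monoˡ-< (natural n) 0<1)

  0≤natural : ∀ n → 0# ≤ natural n
  0≤natural zero    = ≤-reflexive refl
  0≤natural (suc n) = ≤-trans (0≤natural n) (<⇒≤ (natural-<-suc n))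

  -- Comparing `0#` with the two ends of `natural n < natural (suc n)` leaves only
  -- `0# < natural (suc n)`. Through this the positivity of `κ` allows cancelling `natural κ`.
  natural#0 : ∀ n → natural (suc n) # 0#
  natural#0 n with <-cotrans (natural n) (natural-<-suc n)
  ... | inj₁ n<n = contradiction n<n (<-irrefl refl)
  ... | inj₂ n<1+n with <-cotrans 0# n<1+n
  ...   | inj₁ n<0 = contradiction n<0 (0≤natural n)
  ...   | inj₂ 0<1+n = #-sym (<⇒# 0<1+n)

  natural-suc-1 : ∀ n → natural (suc n) - 1# ≈ natural n
  natural-suc-1 n = trans (+-congʳ (+-comm 1# (natural n))) (//-rightDividesʳ 1# (natural n))

  sum-ones : {f : Vector Carrier n} → (∀ i → f i ≈ 1#) → sum f ≈ natural n
  sum-ones {n} f≈1 = trans (sum-cong-≋ f≈1) (sum-replicate n)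

  sum-≤1 : (f : Vector Carrier n) → (∀ i → f i ≤ 1#) → sum f ≤ natural n
  sum-≤1 {n} f f≤1 = ≤-respʳ-≈ (sum-replicate n) (sum-mono-≤ f≤1)

  sum-zeros : {f : Vector Carrier n} → (∀ i → f i ≈ 0#) → sum f ≈ 0#
  sum-zeros {n} f≈0 = trans (sum-cong-≋ f≈0) (sum-replicate-zero n)

  -- Splitting off entry `i` leaves equal remainders. The subtraction-free form serves both a single
  -- surviving term and a single missing one.
  sum-differ-at : (f g : Vector Carrier n) (i : Fin n) →
    (∀ j → j ≢ i → f j ≈ g j) → sum f + g i ≈ sum g + f i
  sum-differ-at {suc n} f g i f≈g = begin
    sum f + g i                         ≈⟨ +-congʳ (sum-remove f) ⟩
    (f i + sum (removeAt f i)) + g i    ≈⟨ +-congʳ (+-congˡ (sum-cong-≋ λ j → f≈g (punchIn i j) (punchInᵢ≢i i j))) ⟩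
    (f i + sum (removeAt g i)) + g i    ≈⟨ +-congʳ (+-comm _ _) ⟩
    (sum (removeAt g i) + f i) + g i    ≈⟨ +-comm _ _ ⟩
    g i + (sum (removeAt g i) + f i)    ≈⟨ +-assoc _ _ _ ⟨
    (g i + sum (removeAt g i)) + f i    ≈⟨ +-congʳ (sum-remove g) ⟨
    sum g + f i                         ∎

  -- Homogeneous linear systems.

  TrivialKernel : (Fin m → Vector Carrier n) → Set _
  TrivialKernel {n = n} A = ∀ (μ : Vector Carrier n) →
    (∀ r → sum (λ j → μ j * A r j) ≈ 0#) → ∀ j → μ j ≈ 0#

  -- Division-free Gaussian elimination of the first unknown with pivot row `p`: every other row is
  -- scaled by the pivot before a multiple of row `p` is subtracted.
  eliminate : (Fin (suc m) → Vector Carrier (suc n)) → Fin (suc m) →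
    Fin m → Vector Carrier n
  eliminate A p r j = A p zero * A (punchIn p r) (suc j) + - A (punchIn p r) zero * A p (suc j)

  -- A solution `μ` of the reduced system lifts to a solution `ν` of the full one. So `ν` vanishes,
  -- and its later entries are those of `μ` times the pivot, which cancels.
  eliminate-trivialKernel : (A : Fin (suc m) → Vector Carrier (suc n)) (p : Fin (suc m)) →
    A p zero # 0# → TrivialKernel A → TrivialKernel (eliminate A p)
  eliminate-trivialKernel {m} {n} A p a#0 kernel μ eqs j =
    #-cancel a#0 (trans (kernel ν ν-solves (suc j)) (sym (zeroʳ (μ j))))
    where
    α = A p zero

    S : Fin (suc m) → Carrier
    S r = sum λ k → μ k * A r (suc k)

    -- Scaling `μ` by `α` lets the pivot row be solved for the first unknown without dividing.
    ν : Vector Carrier (suc n)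
    ν = (- S p) ∷ λ k → μ k * α

    tail-sum : ∀ r → sum (λ k → (μ k * α) * A r (suc k)) ≈ α * S r
    tail-sum r = begin
      sum (λ k → (μ k * α) * A r (suc k))  ≈⟨ sum-cong-≋ (λ k → trans (*-congʳ (*-comm (μ k) α)) (*-assoc α (μ k) (A r (suc k)))) ⟩
      sum (λ k → α * (μ k * A r (suc k)))  ≈⟨ *-distribˡ-sum α (λ k → μ k * A r (suc k)) ⟨
      α * S r                              ∎

    -Sp*b : ∀ b → - S p * b ≈ - b * S p
    -Sp*b b = begin
      - S p * b    ≈⟨ -‿distribˡ-* (S p) b ⟨
      - (S p * b)  ≈⟨ -‿cong (*-comm (S p) b) ⟩
      - (b * S p)  ≈⟨ -‿distribˡ-* b (S p) ⟩
      - b * S p    ∎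

    ν-row : ∀ r → sum (λ k → ν k * A r k) ≈ - A r zero * S p + α * S r
    ν-row r = +-cong (-Sp*b (A r zero)) (tail-sum r)

    distrib-swap : ∀ b u x y → u * (α * x + b * y) ≈ α * (u * x) + b * (u * y)
    distrib-swap b u x y = trans (distribˡ u _ _) (+-cong (*-swap α x) (*-swap b y))
      where
      *-swap : ∀ a x → u * (a * x) ≈ a * (u * x)
      *-swap a x = trans (sym (*-assoc u a x)) (trans (*-congʳ (*-comm u a)) (*-assoc a u x))

    other-row : ∀ r → sum (λ k → ν k * A (punchIn p r) k) ≈ 0#
    other-row r = begin
      sum (λ k → ν k * A r′ k)                ≈⟨ ν-row r′ ⟩
      - β * S p + α * S r′                    ≈⟨ +-comm _ _ ⟩
      α * S r′ + - β * S p                    ≈⟨ +-cong (*-distribˡ-sum α (λ k → μ k * A r′ (suc k))) (*-distribˡ-sum (- β) (λ k → μ k * A p (suc k))) ⟩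
      sum (λ k → α * (μ k * A r′ (suc k))) + sum (λ k → - β * (μ k * A p (suc k)))
                                              ≈⟨ ∑-distrib-+ (λ k → α * (μ k * A r′ (suc k))) (λ k → - β * (μ k * A p (suc k))) ⟨
      sum (λ k → α * (μ k * A r′ (suc k)) + - β * (μ k * A p (suc k)))
                                              ≈⟨ sum-cong-≋ (λ k → distrib-swap (- β) (μ k) (A r′ (suc k)) (A p (suc k))) ⟨
      sum (λ k → μ k * eliminate A p r k)     ≈⟨ eqs r ⟩
      0#                                      ∎
      where
      r′ = punchIn p r
      β  = A r′ zero

    ν-solves : ∀ r → sum (λ k → ν k * A r k) ≈ 0#
    ν-solves r with p ≟ r
    ... | no p≢r = ≡.subst (λ r → sum (λ k → ν k * A r k) ≈ 0#) (punchIn-punchOut p≢r)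
                     (other-row (punchOut p≢r))
    ... | yes ≡.refl = begin
      sum (λ k → ν k * A p k)  ≈⟨ ν-row p ⟩
      - α * S p + α * S p      ≈⟨ distribʳ (S p) (- α) α ⟨
      (- α + α) * S p          ≈⟨ *-congʳ (-‿inverseˡ α) ⟩
      0# * S p                 ≈⟨ zeroˡ (S p) ⟩
      0#                       ∎

  -- Refuting the existence of a pivot in the first column makes that column
  -- zero by tightness, so no case distinction on reals is needed.
  more-unknowns⇒¬trivialKernel : m ℕ.< n → (A : Fin m → Vector Carrier n) → ¬ TrivialKernel A
  more-unknowns⇒¬trivialKernel {n = suc n} m<n A kernel =
    <-irrefl (sym (kernel e e-solves zero)) 0<1
    where
    no-pivot : ∀ {m} → m ℕ.< suc n → (A : Fin m → Vector Carrier (suc n)) →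
      TrivialKernel A → ∀ r → ¬ (A r zero # 0#)
    -- Elimination removes one equation and one unknown, so unknowns still outnumber equations.
    no-pivot {suc m} m<n A kernel r a#0 = more-unknowns⇒¬trivialKernel (s<s⁻¹ m<n)
      (eliminate A r) (eliminate-trivialKernel A r a#0 kernel)

    -- Once the first column vanishes, the first unit vector is a nonzero solution.
    e : Vector Carrier (suc n)
    e = 1# ∷ λ _ → 0#

    e-solves : ∀ r → sum (λ k → e k * A r k) ≈ 0#
    e-solves r = begin
      1# * A r zero + sum (λ k → 0# * A r (suc k))  ≈⟨ +-cong (*-identityˡ _) (sum-zeros λ k → zeroˡ (A r (suc k))) ⟩
      A r zero + 0#                                 ≈⟨ +-identityʳ _ ⟩
      A r zero                                      ≈⟨ proj₁ (tight _ _) (no-pivot m<n A kernel r) ⟩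
      0#                                            ∎

-- Finite sets and cyclic indices.

all⊎any : ∀ {n p q} {P : Fin n → Set p} {Q : Fin n → Set q} →
  (∀ i → P i ⊎ Q i) → (∀ i → P i) ⊎ ∃ Q
all⊎any {zero}  _ = inj₁ λ ()
all⊎any {suc n} h with h zero | all⊎any (h ∘ suc)
... | inj₂ q | _            = inj₂ (zero , q)
... | inj₁ _ | inj₂ (i , q) = inj₂ (suc i , q)
... | inj₁ p | inj₁ ps      = inj₁ λ { zero → p ; (suc i) → ps i }

Finite : Set → Set
Finite A = ∃ λ n → Fin n ↔ A

T-finite : ∀ b → Finite (T b)
T-finite true  = 1 , 1↔⊤
T-finite false = 0 , 0↔⊥

Σ-finite : ∀ {n} {B : Fin n → Set} → (∀ i → Finite (B i)) → Finite (Σ (Fin n) B)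
Σ-finite {zero}  _ = 0 , mk↔ₛ′ (λ ()) (λ ()) (λ ()) (λ ())
Σ-finite {suc n} {B} B-finite =
  let m , Fm↔B₀ = B-finite zero
      k , Fk↔ΣB = Σ-finite (B-finite ∘ suc)
  in m ℕ.+ k , ↔-trans +↔⊎ (↔-trans (Fm↔B₀ ⊎-↔ Fk↔ΣB) split)
  where
  split : (B zero ⊎ Σ (Fin n) (B ∘ suc)) ↔ Σ (Fin (suc n)) B
  split = mk↔ₛ′
    (λ { (inj₁ b) → zero , b ; (inj₂ (i , b)) → suc i , b })
    (λ { (zero , b) → inj₁ b ; (suc i , b) → inj₂ (i , b) })
    (λ { (zero , b) → ≡.refl ; (suc i , b) → ≡.refl })
    (λ { (inj₁ b) → ≡.refl ; (inj₂ (i , b)) → ≡.refl })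

-- The closing arc of a cycle has index zero, so arc `j` runs from vertex `pred↻ j` to vertex `j`.
pred↻ : ∀ {k} → Fin (suc k) → Fin (suc k)
pred↻ {k} zero    = fromℕ k
pred↻     (suc i) = inject₁ i

pred↻-injective : ∀ {k} → Injective _≡_ _≡_ (pred↻ {k})
pred↻-injective {x = zero}  {zero}  eq = ≡.refl
pred↻-injective {x = zero}  {suc j} eq = contradiction eq fromℕ≢inject₁
pred↻-injective {x = suc i} {zero}  eq = contradiction (≡.sym eq) fromℕ≢inject₁
pred↻-injective {x = suc i} {suc j} eq = ≡.cong suc (inject₁-injective eq)

-- From the given index `P` descends to zero, wraps round to the last index, and from there descends
-- to every index.
pred↻-closed⇒all : ∀ {k p} (P : Fin (suc k) → Set p) → (∀ i → P i → P (pred↻ i)) →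
  ∃ P → ∀ i → P i
pred↻-closed⇒all P closed (i , Pi) =
  >-weakInduction P (closed zero P₀) (λ j → closed (suc j))
  where
  P₀ : P zero
  P₀ = <-weakInduction (λ j → P j → P zero) id (λ j ih → ih ∘ closed (suc j)) i Pi

-- Arcs and cycles of the graph.

module GraphProperties (G : SimpleGraph) where
  open SimpleGraph G
  open Arc

  arc-≡ : {a b : Arc G} → source a ≡ source b → target a ≡ target b → a ≡ b
  arc-≡ {arc i j e} {arc .i .j e′} ≡.refl ≡.refl = ≡.cong (arc i j) (T-irrelevant e e′)

  _≟ᵃ_ : DecidableEquality (Arc G)
  a ≟ᵃ b = map′ (λ (s , t) → arc-≡ s t) (λ { ≡.refl → ≡.refl , ≡.refl })
    (source a ≟ source b ×-dec target a ≟ target b)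

  arcs-finite : Finite (Arc G)
  arcs-finite =
    let m , Fm↔Σ = Σ-finite λ i → Σ-finite λ j → T-finite (adjacent i j)
    in m , ↔-trans Fm↔Σ (mk↔ₛ′ (λ (i , j , e) → arc i j e) (λ (arc i j e) → i , j , e)
      (λ _ → ≡.refl) (λ _ → ≡.refl))

  source≢target : (a : Arc G) → source a ≢ target a
  source≢target (arc i .i e) ≡.refl = loopless i e

  vertex : (C : Cycle G) → Fin (Cycle.length C) → Vertex
  vertex C = Path.vertex (Cycle.path C)

  vertex-injective : (C : Cycle G) → Injective _≡_ _≡_ (vertex C)
  vertex-injective C = Path.elementary (Cycle.path C)

  target-arcs : (C : Cycle G) → ∀ j → target (Cycle.arcs C j) ≡ vertex C j
  target-arcs C zero    = ≡.refl
  target-arcs C (suc j) = ≡.refl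

  source-arcs : (C : Cycle G) → ∀ j → source (Cycle.arcs C j) ≡ vertex C (pred↻ j)
  source-arcs C zero    = ≡.refl
  source-arcs C (suc j) = ≡.refl

  target-injective : (C : Cycle G) → ∀ i j →
    target (Cycle.arcs C i) ≡ target (Cycle.arcs C j) → i ≡ j
  target-injective C i j eq = vertex-injective C
    (≡.trans (≡.sym (target-arcs C i)) (≡.trans eq (target-arcs C j)))

  source≡target-pred↻ : (C : Cycle G) → ∀ j →
    source (Cycle.arcs C j) ≡ target (Cycle.arcs C (pred↻ j))
  source≡target-pred↻ C j = ≡.trans (source-arcs C j) (≡.sym (target-arcs C (pred↻ j)))

  infix 4 _on_
  _on_ : Arc G → Cycle G → Set
  a on C = ∃ λ j → Cycle.arcs C j ≡ a

  _on?_ : ∀ a C → Dec (a on C)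
  a on? C = any? λ j → Cycle.arcs C j ≟ᵃ a

  -- The arcs of `C` lying on `D` are closed under predecessor: the arc before a shared arc in `D`
  -- lies on `C`, and `C` has only one arc entering that vertex.
  cycle-in-cycle : (C D : Cycle G) → (∀ i → Cycle.arcs D i on C) → ∀ j → Cycle.arcs C j on D
  cycle-in-cycle C D D⊆C = pred↻-closed⇒all (λ j → Cycle.arcs C j on D) closed
    (proj₁ (D⊆C zero) , zero , ≡.sym (proj₂ (D⊆C zero)))
    where
    closed : ∀ j → Cycle.arcs C j on D → Cycle.arcs C (pred↻ j) on D
    closed j (i , Di≡Cj) with D⊆C (pred↻ i)
    ... | j′ , Cj′≡D = pred↻ i , ≡.trans (≡.sym Cj′≡D) (≡.cong (Cycle.arcs C) j′≡pred-j)
      where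
      open ≡-Reasoning
      j′≡pred-j : j′ ≡ pred↻ j
      j′≡pred-j = target-injective C j′ (pred↻ j) (begin
        target (Cycle.arcs C j′)         ≡⟨ ≡.cong target Cj′≡D ⟩
        target (Cycle.arcs D (pred↻ i))  ≡⟨ source≡target-pred↻ D i ⟨
        source (Cycle.arcs D i)          ≡⟨ ≡.cong source Di≡Cj ⟩
        source (Cycle.arcs C j)          ≡⟨ source≡target-pred↻ C j ⟩
        target (Cycle.arcs C (pred↻ j))  ∎)

  -- Moves the start back by one vertex, which makes the last arc of `C` the closing one.
  rotate : Cycle G → Cycle G
  rotate C = record
    { path    = record
      { vertex     = vertex C ∘ pred↻
      ; elementary = pred↻-injective ∘ vertex-injective C
      ; edges      = λ i → edge-at (inject₁ i)
      }
    ; closing = edge-at (fromℕ (Cycle.k C))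
    }
    where
    edge-at : ∀ j → T (adjacent (vertex C (pred↻ j)) (vertex C j))
    edge-at j = ≡.subst₂ (λ u v → T (adjacent u v)) (source-arcs C j) (target-arcs C j)
      (edge (Cycle.arcs C j))

  arcs-rotate : (C : Cycle G) → ∀ j → Cycle.arcs (rotate C) j ≡ Cycle.arcs C (pred↻ j)
  arcs-rotate C j = arc-≡
    (≡.trans (source-arcs (rotate C) j) (≡.sym (source-arcs C (pred↻ j))))
    (≡.trans (target-arcs (rotate C) j) (≡.sym (target-arcs C (pred↻ j))))

  -- Makes the edge bound a consequence of acyclicity. Index zero is the reverse of the given arc,
  -- index one the arc itself.
  2-cycle : Arc G → Cycle G
  2-cycle a@(arc i j e) = record
    { k       = 1
    ; path    = record
      { vertex     = i ∷ λ _ → j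
      ; elementary = λ { {zero}     {zero}     _  → ≡.refl
                       ; {zero}     {suc zero} eq → contradiction eq (source≢target a)
                       ; {suc zero} {zero}     eq → contradiction (≡.sym eq) (source≢target a)
                       ; {suc zero} {suc zero} _  → ≡.refl }
      ; edges      = λ { zero → e }
      }
    ; closing = symmetric i j e
    }

  -- Exchanging an arc of a cycle.

  module _ (C : Cycle G) where

    -- The value zero is arbitrary when no arc of C enters the vertex.
    entering : Vertex → Fin (Cycle.length C)
    entering v with any? (λ j → target (Cycle.arcs C j) ≟ v)
    ... | yes (j , _) = j
    ... | no _        = zero

    entering-correct : ∀ j {v} → target (Cycle.arcs C j) ≡ v → j ≡ entering v
    entering-correct j {v} t≡v with any? (λ j → target (Cycle.arcs C j) ≟ v)
    ... | yes (j′ , t′≡v) = target-injective C j j′ (≡.trans t≡v (≡.sym t′≡v))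
    ... | no ∄j           = contradiction (j , t≡v) ∄j

    -- For `a` on `C` this is its predecessor. The default value of `entering` still names an arc of
    -- `C`, so an arc of `C` is removed in every case.
    exchanged : Arc G → Arc G
    exchanged a = Cycle.arcs C (entering (source a))

    exchanged-arcs : ∀ j {a} → Cycle.arcs C j ≡ a → Cycle.arcs C (pred↻ j) ≡ exchanged a
    exchanged-arcs j ≡.refl = ≡.cong (Cycle.arcs C)
      (entering-correct (pred↻ j) (≡.sym (source≡target-pred↻ C j)))

    Exchange : Arc G → Arc G → Set
    Exchange a b = (b on C ⊎ b ≡ a) × b ≢ exchanged a

    exchange? : ∀ a b → Dec (Exchange a b)
    exchange? a b = (b on? C ⊎-dec b ≟ᵃ a) ×-dec ¬? (b ≟ᵃ exchanged a)

    exchange-acyclic : ∀ a (D : Cycle G) → ∃ λ i → ¬ Exchange a (Cycle.arcs D i)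
    exchange-acyclic a D = ¬∀⟶∃¬ _ _ (λ i → exchange? a (Cycle.arcs D i)) λ D⊆Exchange →
      let -- A cycle through a would have to enter the source of a.
          D∌a : ∀ i → Cycle.arcs D i ≢ a
          D∌a i Di≡a = case-pred i Di≡a (D⊆Exchange (pred↻ i))

          D⊆C : ∀ i → Cycle.arcs D i on C
          D⊆C i = on-C (D∌a i) (proj₁ (D⊆Exchange i))

          -- Lying inside `C`, the cycle `D` contains all of `C`, including the removed arc.
          i , Di≡exchanged = cycle-in-cycle C D D⊆C (entering (source a))
      in proj₂ (D⊆Exchange i) Di≡exchanged
      where
      on-C : ∀ {b} → b ≢ a → b on C ⊎ b ≡ a → b on C
      on-C b≢a (inj₁ b∈C) = b∈C
      on-C b≢a (inj₂ b≡a) = contradiction b≡a b≢a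

      case-pred : ∀ i → Cycle.arcs D i ≡ a → ¬ Exchange a (Cycle.arcs D (pred↻ i))
      -- The arc of `D` before `a` cannot be `a`, which is no loop; if it lies on `C`, it enters the
      -- source of `a` and is the removed arc.
      case-pred i Di≡a (inj₂ b≡a , _) = source≢target a
        (≡.trans (≡.sym (≡.cong source Di≡a)) (≡.trans (source≡target-pred↻ D i) (≡.cong target b≡a)))
      case-pred i Di≡a (inj₁ (j , Cj≡b) , b≢) = b≢ (≡.trans (≡.sym Cj≡b)
        (≡.cong (Cycle.arcs C) (entering-correct j
          (≡.trans (≡.cong target Cj≡b)
            (≡.trans (≡.sym (source≡target-pred↻ D i)) (≡.cong source Di≡a))))))

-- Linear functionals, affine independence and dimension.

module AffineGeometry {c ℓ₁ ℓ₂} (R : RealNumbers c ℓ₁ ℓ₂) (G : SimpleGraph) where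
  open OrderedField R
  open Polyhedral R G
  open SetoidReasoning setoid

  record IsLinear (φ : Point → Carrier) : Set (c ⊔ ℓ₁) where
    field
      cong             : ∀ {x y} → x ≋ y → φ x ≈ φ y
      combination-homo : ∀ {k} (μ : Vector Carrier k) (p : Vector Point k) →
                         φ (combination μ p) ≈ sum (λ i → μ i * φ (p i))

    combination≋0 : ∀ {k} (μ : Vector Carrier k) (p : Vector Point k) →
      combination μ p ≋ origin → sum (λ i → μ i * φ (p i)) ≈ 0#
    combination≋0 μ p eq = begin
      sum (λ i → μ i * φ (p i))  ≈⟨ combination-homo μ p ⟨
      φ (combination μ p)        ≈⟨ cong eq ⟩
      -- The origin is the empty combination.
      φ origin                   ≈⟨ combination-homo {zero} (λ ()) (λ ()) ⟩
      0#                         ∎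

  z-linear : IsLinear z
  z-linear = record { cong = proj₂ ; combination-homo = λ μ p → refl }

  weight-linear : ∀ {k} (as : Vector (Arc G) k) → IsLinear (weight as)
  weight-linear as = record
    { cong             = λ eq → sum-cong-≋ (proj₁ eq ∘ as)
    ; combination-homo = λ μ p → begin
        sum (λ j → sum (λ i → μ i * w (p i) (as j)))  ≈⟨ ∑-comm (λ j i → μ i * w (p i) (as j)) ⟩
        sum (λ i → sum (λ j → μ i * w (p i) (as j)))  ≈⟨ sum-cong-≋ (λ i → *-distribˡ-sum (μ i) (w (p i) ∘ as)) ⟨
        sum (λ i → μ i * weight as (p i))             ∎
    }

  ⊆-convexHull : ∀ {ℓ} (S : Pred Point ℓ) → S ⊆ ConvexHull S
  ⊆-convexHull S {x} x∈S = 1 , (λ _ → 1#) , (λ _ → x) , (λ _ → <⇒≤ 0<1) , +-identityʳ 1# , (λ _ → x∈S) ,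
    (λ a → 1*x+0 (w x a)) , 1*x+0 (z x)
    where
    1*x+0 : ∀ y → y ≈ 1# * y + 0#
    1*x+0 y = sym (trans (+-identityʳ (1# * y)) (*-identityˡ y))

  convexHull-valid : ∀ {ℓ} {S : Pred Point ℓ} {f g} → IsLinear f → IsLinear g →
    S ⊆ (λ x → f x ≤ g x) → ConvexHull S ⊆ (λ x → f x ≤ g x)
  convexHull-valid f-linear g-linear f≤g (k , μ , p , 0≤μ , _ , p∈S , x≋comb) =
    ≤-respˡ-≈ (sym (trans (Φ.cong x≋comb) (Φ.combination-homo μ p)))
      (≤-respʳ-≈ (sym (trans (Γ.cong x≋comb) (Γ.combination-homo μ p)))
        (sum-mono-≤ λ i → *-monoʳ-≤ (0≤μ i) (f≤g (p∈S i))))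
    where
    module Φ = IsLinear f-linear
    module Γ = IsLinear g-linear

  -- Affine independence says that a system of `m + 2` equations in the coefficients has only the
  -- zero solution: one for their sum, one for `z`, one for each arc.
  affinelyIndependent⇒≤ : ∀ {m} (enum : Fin m → Arc G) → (∀ a → ∃ λ r → enum r ≡ a) →
    ∀ {l} (q : Vector Point l) → AffinelyIndependent q → l ℕ.≤ suc (suc m)
  affinelyIndependent⇒≤ {m} enum surj {l} q indep = ℕ.≮⇒≥ λ m+2<l →
    more-unknowns⇒¬trivialKernel m+2<l rows kernel
    where
    rows : Fin (suc (suc m)) → Vector Carrier l
    rows zero          i = 1#
    rows (suc zero)    i = z (q i)
    rows (suc (suc r)) i = w (q i) (enum r)

    kernel : TrivialKernel rows
    kernel μ eqs = indep μ (trans (sym (sum-cong-≋ (*-identityʳ ∘ μ))) (eqs zero))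
      ((λ a → let r , enum-r≡a = surj a in
         ≡.subst (λ a → sum (λ i → μ i * w (q i) a) ≈ 0#) enum-r≡a (eqs (suc (suc r)))) ,
       eqs (suc zero))

  -- On the hyperplane f = g a combination takes the same values under f and
  -- g, which forces the coefficient of a point off the hyperplane to vanish.
  ∷-affinelyIndependent : ∀ {f g} → IsLinear f → IsLinear g →
    ∀ x → f x # g x → ∀ {k} (q : Vector Point k) → (∀ i → f (q i) ≈ g (q i)) →
    AffinelyIndependent q → AffinelyIndependent (x ∷ q)
  ∷-affinelyIndependent {f} {g} f-linear g-linear x fx#gx {k} q q∈face indep μ ∑μ≈0 (w≈0 , z≈0) = λ
    { zero    → μ₀≈0
    ; (suc i) → indep (tail μ) (drop-head μ₀≈0 ∑μ≈0)
        ((λ a → drop-head (μ₀*≈0 (w x a)) (w≈0 a)) , drop-head (μ₀*≈0 (z x)) z≈0) i }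
    where
    drop-head : ∀ {a b} → a ≈ 0# → a + b ≈ 0# → b ≈ 0#
    drop-head {a} {b} a≈0 a+b≈0 = trans (sym (trans (+-congʳ a≈0) (+-identityˡ b))) a+b≈0

    μ₀≈0 : head μ ≈ 0#
    μ₀≈0 = #-cancel fx#gx (+-cancelʳ (sum λ i → tail μ i * g (q i)) _ _ (begin
      head μ * f x + sum (λ i → tail μ i * g (q i))  ≈⟨ +-congˡ (sum-cong-≋ λ i → *-congˡ (q∈face i)) ⟨
      head μ * f x + sum (λ i → tail μ i * f (q i))  ≈⟨ IsLinear.combination≋0 f-linear μ (x ∷ q) (w≈0 , z≈0) ⟩
      0#                                             ≈⟨ IsLinear.combination≋0 g-linear μ (x ∷ q) (w≈0 , z≈0) ⟨
      head μ * g x + sum (λ i → tail μ i * g (q i))  ∎))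

    μ₀*≈0 : ∀ y → head μ * y ≈ 0#
    μ₀*≈0 y = trans (*-congʳ μ₀≈0) (zeroˡ y)

  -- The single bound `suc n` settles both dimensions: `x ∷ q` attains it in `P`, and prepending `x`
  -- to a family on the face shows that such a family has at most `n` members.
  facet-criterion : ∀ {ℓ} {P : Pred Point ℓ} {f g} → IsLinear f → IsLinear g →
    P ⊆ (λ x → f x ≤ g x) →
    ∀ {n} (q : Vector Point n) → (∀ i → q i ∈ P ∩ λ x → f x ≈ g x) → AffinelyIndependent q →
    ∀ x → x ∈ P → f x # g x →
    (∀ {l} (r : Vector Point l) → AffinelyIndependent r → l ℕ.≤ suc n) →
    DefinesFacet P f g
  facet-criterion f-linear g-linear valid {n} q q∈face indep x x∈P fx#gx bound =
    valid , (ℤ.+ suc n ℤ.- ℤ.1ℤ) ,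
    (suc n , ≡.refl , (x ∷ q , (λ { zero → x∈P ; (suc i) → proj₁ (q∈face i) }) , cone q (proj₂ ∘ q∈face) indep) ,
      λ r _ → bound r) ,
    (n , ≡.refl , (q , q∈face , indep) ,
      λ r r∈face r-indep → s≤s⁻¹ (bound (x ∷ r) (cone r (proj₂ ∘ r∈face) r-indep)))
    where
    cone = ∷-affinelyIndependent f-linear g-linear x fx#gx

  indicator : ∀ {p} {P : Set p} → Dec P → Carrier
  indicator (yes _) = 1#
  indicator (no _)  = 0#

  indicator-true : ∀ {p} {P : Set p} (P? : Dec P) → P → indicator P? ≈ 1#
  indicator-true (yes _) _ = refl
  indicator-true (no ¬p) p = contradiction p ¬p

  indicator-false : ∀ {p} {P : Set p} (P? : Dec P) → ¬ P → indicator P? ≈ 0#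
  indicator-false (yes p) ¬p = contradiction p ¬p
  indicator-false (no _)  _  = refl

  indicator-binary : ∀ {p} {P : Set p} (P? : Dec P) → indicator P? ≈ 0# ⊎ indicator P? ≈ 1#
  indicator-binary (yes _) = inj₂ refl
  indicator-binary (no _)  = inj₁ refl

  indicator≤1 : ∀ {p} {P : Set p} (P? : Dec P) → indicator P? ≤ 1#
  indicator≤1 (yes _) = ≤-reflexive refl
  indicator≤1 (no _)  = <⇒≤ 0<1

-- Feasible points and validity.

module Facet {c ℓ₁ ℓ₂} (R : RealNumbers c ℓ₁ ℓ₂) (G : SimpleGraph) where
  open OrderedField R
  open Polyhedral R G
  open AffineGeometry R G
  open GraphProperties G
  open SetoidReasoning setoid

  -- An arc missing from each cycle gives the cycle bounds, and for cycles of length two the edge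
  -- bounds. The path bound depends on `ζ` and is left to the caller.
  acyclic-feasible : ∀ {p κ ζ} {S : Pred (Arc G) p} (S? : ∀ a → Dec (S a)) →
    (∀ (D : Cycle G) → ∃ λ i → ¬ S (Cycle.arcs D i)) →
    0# ≤ ζ → ζ ≤ natural κ →
    (∀ (p : Path G κ) → weight (Path.arcs p) (point (indicator ∘ S?) ζ) ≤ ζ) →
    Feasible κ (point (indicator ∘ S?) ζ)
  acyclic-feasible {S = S} S? acyclic 0≤ζ ζ≤κ path-bound = record
    { edge-bound  = edge-bound
    ; cycle-bound = cycle-bound
    ; path-bound  = path-bound
    ; binary      = λ a → indicator-binary (S? a)
    ; z-lower     = 0≤ζ
    ; z-upper     = ζ≤κ
    }
    where
    χ : Arc G → Carrier
    χ a = indicator (S? a)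

    edge-bound : ∀ a → χ a + χ (reverse G a) ≤ 1#
    edge-bound a with acyclic (2-cycle a)
    ... | zero , rev∉S = ≤-respʳ-≈ (+-identityʳ 1#)
      (+-mono-≤ (indicator≤1 (S? a)) (≤-reflexive (indicator-false (S? (reverse G a)) rev∉S)))
    ... | suc zero , a∉S = ≤-respʳ-≈ (+-identityˡ 1#)
      (+-mono-≤ (≤-reflexive (indicator-false (S? a) a∉S)) (indicator≤1 (S? (reverse G a))))

    cycle-bound : ∀ D → sum (χ ∘ Cycle.arcs D) ≤ natural (Cycle.length D) - 1#
    cycle-bound D with acyclic D
    ... | i , Di∉S = ≤-respˡ-≈ (sym (sum-remove {i = i} f)) (≤-respʳ-≈ 0+n≈n+1-1
      (+-mono-≤ (≤-reflexive (indicator-false (S? (Cycle.arcs D i)) Di∉S))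
        (sum-≤1 (removeAt f i) λ j → indicator≤1 (S? (Cycle.arcs D (punchIn i j))))))
      where
      f = χ ∘ Cycle.arcs D
      0+n≈n+1-1 : 0# + natural (Cycle.k D) ≈ natural (Cycle.length D) - 1#
      0+n≈n+1-1 = trans (+-identityˡ _) (sym (natural-suc-1 (Cycle.k D)))

  -- Rotating C until an arc of value zero becomes the closing arc exhibits
  -- the weight of C as the weight of a path.
  cycle≤z : ∀ (C : Cycle G) {x} → Feasible (Cycle.k C) x → weight (Cycle.arcs C) x ≤ z x
  cycle≤z C {x} feasible with all⊎any (swap ∘ Feasible.binary feasible ∘ Cycle.arcs C)
  -- With all values one, the weight would be the length of `C`, exceeding the cycle bound.
  ... | inj₁ all-one = contradiction (<-respˡ-≈ (sym (natural-suc-1 (Cycle.k C)))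
          (<-respʳ-≈ (sym (sum-ones {f = w x ∘ Cycle.arcs C} all-one)) (natural-<-suc (Cycle.k C))))
          (Feasible.cycle-bound feasible C)
  ... | inj₂ (j , wj≈0) = from-zero j (Cycle.path C) (Cycle.closing C) wj≈0
    where
    k = Cycle.k C

    cycle : (p : Path G k) → _ → Cycle G
    cycle p closing = record { path = p ; closing = closing }

    -- Quantified over all cycles of this length, because rotating changes the cycle.
    P : Fin (suc k) → Set _
    P j = ∀ p closing → w x (Cycle.arcs (cycle p closing) j) ≈ 0# →
      weight (Cycle.arcs (cycle p closing)) x ≤ z x

    weight-rotate : ∀ p closing → let D = cycle p closing in
      weight (Cycle.arcs (rotate D)) x ≈ weight (Cycle.arcs D) x
    weight-rotate p closing = begin
      sum (w x ∘ Cycle.arcs (rotate D))  ≈⟨ sum-cong-≋ (λ j → reflexive (≡.cong (w x) (arcs-rotate D j))) ⟩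
      f (fromℕ k) + sum (f ∘ inject₁)    ≈⟨ +-comm _ _ ⟩
      sum (f ∘ inject₁) + f (fromℕ k)    ≈⟨ sum-init-last f ⟨
      sum f                              ∎
      where
      D = cycle p closing
      f = w x ∘ Cycle.arcs D

    -- Arc `pred↻ j` of a cycle is arc `j` of its rotation, which has the same weight.
    via-rotation : ∀ j → P j → P (pred↻ j)
    via-rotation j Pj p closing w≈0 = ≤-respˡ-≈ (weight-rotate p closing)
      (Pj (Cycle.path (rotate D)) (Cycle.closing (rotate D))
        (trans (reflexive (≡.cong (w x) (arcs-rotate D j))) w≈0))
      where D = cycle p closing

    from-closing : P zero
    from-closing p closing w≈0 =
      ≤-respˡ-≈ (sym (trans (+-congʳ w≈0) (+-identityˡ _))) (Feasible.path-bound feasible p)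

    from-zero : ∀ j → P j
    from-zero = pred↻-closed⇒all P via-rotation (zero , from-closing)

  zeroPoint : Carrier → Point
  zeroPoint = point λ _ → 0#

  weight-zeroPoint : ∀ {n} (as : Vector (Arc G) n) ζ → weight as (zeroPoint ζ) ≈ 0#
  weight-zeroPoint {n} as ζ = sum-zeros {n} λ _ → refl

  -- The case of the empty arc set. Taking `ζ` to be `0#` gives the origin; `natural κ` gives the
  -- apex of the cone.
  zeroPoint-feasible : ∀ {κ ζ} → 0# ≤ ζ → ζ ≤ natural κ → Feasible κ (zeroPoint ζ)
  zeroPoint-feasible {κ} {ζ} 0≤ζ ζ≤κ = acyclic-feasible {S = λ _ → ⊥} (λ _ → no id)
    (λ _ → zero , id) 0≤ζ ζ≤κ λ p → ≤-respˡ-≈ (sym (weight-zeroPoint (Path.arcs p) ζ)) 0≤ζ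

  -- Independent points on the face.

  module _ (C : Cycle G) where
    private
      k = Cycle.k C
      m = proj₁ arcs-finite
      open Inverse (proj₂ arcs-finite) using () renaming
        (to to arcAt; from to indexOf; strictlyInverseˡ to arcAt-indexOf; strictlyInverseʳ to indexOf-arcAt)

    arcAt-injective : ∀ {i j} → arcAt i ≡ arcAt j → i ≡ j
    arcAt-injective {i} {j} eq = ≡.trans (≡.sym (indexOf-arcAt i))
      (≡.trans (≡.cong indexOf eq) (indexOf-arcAt j))

    exchangePoint : Arc G → Point
    exchangePoint a = point (λ b → indicator (exchange? C a b)) (natural k)

    -- A path of `k` arcs weighs at most `k`, which is the value given to `z`.
    exchangePoint-feasible : ∀ a → Feasible k (exchangePoint a)
    exchangePoint-feasible a = acyclic-feasible (exchange? C a) (exchange-acyclic C a)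
      (0≤natural k) (≤-reflexive refl) λ p →
        sum-≤1 (λ i → indicator (exchange? C a (Path.arcs p i))) λ i →
          indicator≤1 (exchange? C a (Path.arcs p i))

    -- Of the `k + 1` arcs of `C` exactly one is lost; the sum is compared with that of the constant
    -- vector `1#`.
    exchangePoint-tight : ∀ a → weight (Cycle.arcs C) (exchangePoint a) ≈ natural k
    exchangePoint-tight a = +-cancelʳ 1# _ _ (begin
      sum f + 1#                     ≈⟨ sum-differ-at f (λ _ → 1#) e others ⟩
      sum {suc k} (λ _ → 1#) + f e   ≈⟨ +-cong (sum-replicate (suc k)) e-removed ⟩
      natural (suc k) + 0#           ≈⟨ +-identityʳ _ ⟩
      1# + natural k                 ≈⟨ +-comm _ _ ⟩
      natural k + 1#                 ∎)
      where
      e = entering C (Arc.source a)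
      f : Vector Carrier (suc k)
      f j = indicator (exchange? C a (Cycle.arcs C j))
      e-removed : f e ≈ 0#
      e-removed = indicator-false (exchange? C a (Cycle.arcs C e)) λ (_ , e≢) → e≢ ≡.refl
      others : ∀ j → j ≢ e → f j ≈ 1#
      others j j≢e = indicator-true (exchange? C a (Cycle.arcs C j))
        (inj₁ (j , ≡.refl) , λ eq → j≢e (target-injective C j e (≡.cong Arc.target eq)))

    facetPoints : Vector Point (suc m)
    facetPoints = origin ∷ (exchangePoint ∘ arcAt)

    facetPoints-independent : natural k # 0# → AffinelyIndependent facetPoints
    facetPoints-independent k#0 μ ∑μ≈0 (w≈0 , z≈0) = λ { zero → μ₀≈0 ; (suc i) → ν≈0 i }
      where
      ν : Vector Carrier m
      ν = tail μ

      drop-origin : ∀ {b} → head μ * 0# + b ≈ 0# → b ≈ 0#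
      drop-origin {b} eq = trans (sym (trans (+-congʳ (zeroʳ (head μ))) (+-identityˡ b))) eq

      coordinate : ∀ b → sum (λ i → ν i * indicator (exchange? C (arcAt i) b)) ≈ 0#
      coordinate b = drop-origin (w≈0 b)

      -- All points except the origin share the `z`-coordinate `natural k`, which is cancelled.
      ∑ν≈0 : sum ν ≈ 0#
      ∑ν≈0 = #-cancel k#0 (begin
        sum ν * natural k            ≈⟨ *-distribʳ-sum (natural k) ν ⟩
        sum (λ i → ν i * natural k)  ≈⟨ drop-origin z≈0 ⟩
        0#                           ≈⟨ zeroʳ (sum ν) ⟨
        sum ν * 0#                   ∎)

      μ₀≈0 : head μ ≈ 0#
      μ₀≈0 = trans (sym (trans (+-congˡ ∑ν≈0) (+-identityʳ (head μ)))) ∑μ≈0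

      module _ (i : Fin m) (b : Arc G) where
        term : Vector Carrier m
        term j = ν j * indicator (exchange? C (arcAt j) b)

        term-in : ∀ j → Exchange C (arcAt j) b → term j ≈ ν j
        term-in j b∈ = trans (*-congˡ (indicator-true (exchange? C (arcAt j) b) b∈)) (*-identityʳ (ν j))

        term-out : ∀ j → ¬ Exchange C (arcAt j) b → term j ≈ 0#
        term-out j b∉ = trans (*-congˡ (indicator-false (exchange? C (arcAt j) b) b∉)) (zeroʳ (ν j))

        only⇒ν≈0 : (∀ j → Exchange C (arcAt j) b → j ≡ i) → Exchange C (arcAt i) b → ν i ≈ 0#
        only⇒ν≈0 only b∈ = begin
          ν i                          ≈⟨ term-in i b∈ ⟨
          term i                       ≈⟨ +-identityˡ _ ⟨
          0# + term i                  ≈⟨ +-congʳ (sum-replicate-zero m) ⟨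
          sum {m} (λ _ → 0#) + term i  ≈⟨ sum-differ-at term (λ _ → 0#) i (λ j j≢i → term-out j (j≢i ∘ only j)) ⟨
          sum term + 0#                ≈⟨ +-identityʳ _ ⟩
          sum term                     ≈⟨ coordinate b ⟩
          0#                           ∎

        -- Coordinate `b` then reads `sum ν` without `ν i`. Comparing terms rather than membership
        -- also admits points whose coefficient is already known to vanish.
        all-but⇒ν≈0 : (∀ j → j ≢ i → term j ≈ ν j) → ¬ Exchange C (arcAt i) b → ν i ≈ 0#
        all-but⇒ν≈0 all-but b∉ = begin
          ν i                    ≈⟨ +-identityˡ _ ⟨
          0# + ν i               ≈⟨ +-congʳ (coordinate b) ⟨
          sum term + ν i         ≈⟨ sum-differ-at term ν i all-but ⟩
          sum ν + term i         ≈⟨ +-cong ∑ν≈0 (term-out i b∉) ⟩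
          0# + 0#                ≈⟨ +-identityˡ _ ⟩
          0#                     ∎

      -- An arc off `C` lies in its own exchange set only, and is not the removed arc, which is on
      -- `C`.
      off⇒ν≈0 : ∀ i → ¬ arcAt i on C → ν i ≈ 0#
      off⇒ν≈0 i i∉C = only⇒ν≈0 i (arcAt i)
        (λ { j (inj₁ i∈C , _) → contradiction i∈C i∉C
           ; j (inj₂ i≡j , _) → arcAt-injective (≡.sym i≡j) })
        (inj₂ ≡.refl , λ eq → i∉C (entering C (Arc.source (arcAt i)) , ≡.sym eq))

      -- The coordinate used is that of the predecessor `b` of arc `i`. Among the points for arcs on
      -- `C` only this one lacks `b`, as `pred↻` is injective; arcs off `C` have coefficient zero
      -- already.
      on⇒ν≈0 : ∀ i → arcAt i on C → ν i ≈ 0#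
      on⇒ν≈0 i (c , Cc≡i) = all-but⇒ν≈0 i b all-but λ (_ , b≢) → b≢ (exchanged-arcs C c Cc≡i)
        where
        b = Cycle.arcs C (pred↻ c)

        all-but : ∀ j → j ≢ i → term i b j ≈ ν j
        all-but j j≢i with arcAt j on? C
        ... | no j∉C = trans (*-congʳ νj≈0) (trans (zeroˡ _) (sym νj≈0))
          where νj≈0 = off⇒ν≈0 j j∉C
        ... | yes (d , Cd≡j) = term-in i b j (inj₁ (pred↻ c , ≡.refl) , λ b≡ → j≢i (arcAt-injective
              (≡.trans (≡.sym Cd≡j) (≡.trans (≡.cong (Cycle.arcs C) (≡.sym (c≡d b≡))) Cc≡i))))
          where
          c≡d : b ≡ exchanged C (arcAt j) → c ≡ d
          c≡d b≡ = pred↻-injective (target-injective C (pred↻ c) (pred↻ d)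
            (≡.cong Arc.target (≡.trans b≡ (≡.sym (exchanged-arcs C d Cd≡j)))))

      ν≈0 : ∀ i → ν i ≈ 0#
      ν≈0 i with arcAt i on? C
      ... | yes i∈C = on⇒ν≈0 i i∈C
      ... | no  i∉C = off⇒ν≈0 i i∉C

    cycle-facet : natural k # 0# → DefinesFacet (Polytope k) (weight (Cycle.arcs C)) z
    cycle-facet k#0 = facet-criterion (weight-linear (Cycle.arcs C)) z-linear
      (convexHull-valid (weight-linear (Cycle.arcs C)) z-linear λ {x} → cycle≤z C {x})
      facetPoints
      (λ { zero    → in-hull (zeroPoint-feasible (≤-reflexive refl) (0≤natural k)) , weight-zeroPoint (Cycle.arcs C) 0#
         ; (suc i) → in-hull (exchangePoint-feasible (arcAt i)) , exchangePoint-tight (arcAt i) })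
      (facetPoints-independent k#0)
      (zeroPoint (natural k))
      (in-hull (zeroPoint-feasible (0≤natural k) (≤-reflexive refl)))
      (#-sym (#-congˡ (sym (weight-zeroPoint (Cycle.arcs C) (natural k))) k#0))
      (affinelyIndependent⇒≤ arcAt λ a → indexOf a , arcAt-indexOf a)
      where
      in-hull = ⊆-convexHull (Feasible k)

theorem7 : ∀ {c ℓ₁ ℓ₂} (R : RealNumbers c ℓ₁ ℓ₂) (G : SimpleGraph)
    (κ : ℕ) → .{{_ : NonZero κ}} →
    (C : Cycle G) → Cycle.length C ≡ suc κ →
    let open Polyhedral R G in
    DefinesFacet (Polytope κ) (weight (Cycle.arcs C)) z
theorem7 R G (suc κ) C ≡.refl = Facet.cycle-facet R G C (OrderedField.natural#0 R κ)
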